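{- For every fixed nonnegative integer $r$, there exists $N=N(r)$ such that if $M$ is a matroid of rank $r$ on $n\ge N$ elements, then monotonicity holds for $M$.
   Context: Matroid bingo: let $M$ be a matroid on a finite set $E$ with $|E|=n$ and circuit set $\mathcal{C}$. The elements of $E$ are called out one at a time in a uniformly random order $\sigma(1),\sigma(2),\dots,\sigma(n)$ (a uniformly random permutation of $E$). A circuit $C$ wins in round $t$ if $C\subseteq\{\sigma(1),\dots,\sigma(t)\}$ and no circuit of $M$ is contained in $\{\sigma(1),\dots,\sigma(t-1)\}$; thus the winner is the first circuit to be completed (the circuit axioms guarantee that there is no tie). $\beta_C$ denotes the probability that $C$ wins (in some round). Monotonicity holds for $M$ if $\beta_{C_1}<\beta_{C_2}$ whenever $C_1,C_2$ are circuits of $M$ with $|C_1|>|C_2|$. -}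

module Defs where

open import Data.Fin.Base using (Fin; zero; suc; toℕ; punchIn)
open import Data.Fin.Permutation as Perm
  using (Permutation′; _⟨$⟩ʳ_; _⟨$⟩ˡ_)
open import Data.Fin.Properties using (any?; punchIn-injective)
open import Data.Fin.Subset
  using (Subset; _∈_; _∉_; _⊆_; _⊂_; _∪_; ⁅_⁆; ∣_∣) renaming (⊥ to ∅)
open import Data.Fin.Subset.Properties using (anySubset?; _⊆?_; _⊂?_)
open import Data.Integer.Base using (+_)
open import Data.List.Base
  using (List; []; _∷_; length; filter; map; allFin; cartesianProductWith)
open import Data.List.Membership.Propositional.Properties using (∈-allFin)
import Data.List.Membership.Setoid as SetoidMembership
open import Data.List.Membership.Setoid.Properties using (∈-cartesianProductWith⁺)
open import Data.List.Properties
  using (length-tabulate; length-++; length-map)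
open import Data.List.Relation.Unary.All using ([])
open import Data.List.Relation.Unary.AllPairs using ([]; _∷_)
open import Data.List.Relation.Unary.Any using (here)
import Data.List.Relation.Unary.Any as Any
import Data.List.Relation.Unary.Unique.Setoid as SetoidUnique
import Data.List.Relation.Unary.Unique.Setoid.Properties as SetoidUnique
open import Data.List.Relation.Unary.Unique.Propositional.Properties using (allFin⁺)
open import Data.Nat.Base using (ℕ; zero; suc; _+_; _*_; _≤_; _<_; _>_; _!)
open import Data.Nat.Properties using (_<?_; _!≢0)
open import Data.Product.Base using (∃-syntax; _×_; _,_)
open import Data.Rational.Base using (ℚ; _/_)
import Data.Rational.Base as ℚ
open import Data.Vec.Base using (tabulate)
open import Level using (0ℓ)
open import Relation.Binary.Bundles using (Setoid)
open import Relation.Binary.PropositionalEquality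
  using (_≡_; refl; sym; trans; cong; cong₂; setoid)
open import Relation.Nullary using (¬_; does)
open import Relation.Nullary.Decidable
  using (map′; ¬?; _×-dec_; decidable-stable)
open import Relation.Unary using (Pred; Decidable)

private
  variable
    n : ℕ

-- Matroids on the ground set Fin n, given by their independent sets.
-- Independence is a decidable predicate, which classically is no restriction;
-- it is what makes the probabilities below computable.

record Matroid (n : ℕ) : Set₁ where
  field
    Independent  : Pred (Subset n) 0ℓ
    independent? : Decidable Independent
    ∅-independent : Independent ∅
    hereditary    : ∀ {I J} → J ⊆ I → Independent I → Independent J
    augmentation  : ∀ {I J} → Independent I → Independent J → ∣ I ∣ < ∣ J ∣ →
                    ∃[ x ] x ∈ J × x ∉ I × Independent (⁅ x ⁆ ∪ I)

module _ (M : Matroid n) where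
  open Matroid M

  HasRank : ℕ → Set
  HasRank r = (∃[ I ] Independent I × ∣ I ∣ ≡ r)
            × (∀ {I} → Independent I → ∣ I ∣ ≤ r)

  Circuit : Pred (Subset n) 0ℓ
  Circuit C = ¬ Independent C × (∀ {D} → D ⊂ C → Independent D)

  circuit? : Decidable Circuit
  circuit? C = ¬? (independent? C) ×-dec
    map′ (λ ∄D {D} D⊂C → decidable-stable (independent? D) λ ¬iD → ∄D (D , D⊂C , ¬iD))
         (λ f (D , D⊂C , ¬iD) → ¬iD (f D⊂C))
         (¬? (anySubset? λ D → (D ⊂? C) ×-dec ¬? (independent? D)))

  ContainsCircuit : Pred (Subset n) 0ℓ
  ContainsCircuit S = ∃[ D ] Circuit D × D ⊆ S

  containsCircuit? : Decidable ContainsCircuit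
  containsCircuit? S = anySubset? λ D → circuit? D ×-dec (D ⊆? S)

-- The sample space. The head of an ordering of Fin (suc n) is any j; the rest
-- is an ordering of the remaining elements, i.e. one of Fin n.

orderings : ∀ n → List (Permutation′ n)
orderings zero    = Perm.id ∷ []
orderings (suc n) = cartesianProductWith (Perm.insert zero) (allFin (suc n)) (orderings n)

-- Every permutation occurs in orderings n exactly once, up to pointwise
-- equality, so counting in it computes uniform probabilities.

permutationSetoid : ℕ → Setoid 0ℓ 0ℓ
permutationSetoid n = record
  { Carrier       = Permutation′ n
  ; _≈_           = Perm._≈_
  ; isEquivalence = record
    { refl  = λ _ → refl
    ; sym   = λ p i → sym (p i)
    ; trans = λ p q i → trans (p i) (q i)
    }
  }

private
  length-cartesianProductWith : ∀ {A B C : Set} (f : A → B → C) xs ys →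
    length (cartesianProductWith f xs ys) ≡ length xs * length ys
  length-cartesianProductWith f []       ys = refl
  length-cartesianProductWith f (x ∷ xs) ys =
    trans (length-++ (map (f x) ys))
          (cong₂ _+_ (length-map (f x) ys) (length-cartesianProductWith f xs ys))

length-orderings : ∀ n → length (orderings n) ≡ n !
length-orderings zero    = refl
length-orderings (suc n) =
  trans (length-cartesianProductWith (Perm.insert zero) (allFin (suc n)) (orderings n))
        (cong₂ _*_ (length-tabulate {n = suc n} (λ i → i)) (length-orderings n))

private
  insert-cong : ∀ {i j} {π ρ : Permutation′ n} → i ≡ j → π Perm.≈ ρ →
                Perm.insert zero i π Perm.≈ Perm.insert zero j ρ
  insert-cong         refl π≈ρ zero    = refl
  insert-cong {i = i} refl π≈ρ (suc k) = cong (punchIn i) (π≈ρ k)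

  insert-injective : ∀ {i j} {π ρ : Permutation′ n} →
                     Perm.insert zero i π Perm.≈ Perm.insert zero j ρ →
                     i ≡ j × π Perm.≈ ρ
  insert-injective {i = i} eq with refl ← eq zero =
    refl , λ k → punchIn-injective i _ _ (eq (suc k))

orderings-complete : ∀ n (σ : Permutation′ n) →
                     let open SetoidMembership (permutationSetoid n)
                           renaming (_∈_ to _∈ₗ_)
                     in σ ∈ₗ orderings n
orderings-complete zero    σ = here λ ()
orderings-complete (suc n) σ =
  Any.map (λ eq i → trans (sym (Perm.insert-remove zero σ i)) (eq i))
    (∈-cartesianProductWith⁺ (setoid _) (permutationSetoid n) (permutationSetoid (suc n))
      (λ {i} {j} {π} {ρ} → insert-cong {i = i} {j} {π} {ρ})
      (∈-allFin (σ ⟨$⟩ʳ zero))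
      (orderings-complete n (Perm.remove zero σ)))

orderings-unique : ∀ n → SetoidUnique.Unique (permutationSetoid n) (orderings n)
orderings-unique zero    = [] ∷ []
orderings-unique (suc n) =
  SetoidUnique.cartesianProductWith⁺
    (setoid _) (permutationSetoid n) (permutationSetoid (suc n))
    (Perm.insert zero)
    (λ {i} {j} {π} {ρ} → insert-injective {i = i} {j} {π} {ρ})
    (allFin⁺ (suc n))
    (orderings-unique n)

probability : {P : Pred (Permutation′ n) 0ℓ} → Decidable P → ℚ
probability {n} P? = _/_ (+ length (filter P? (orderings n))) (n !) {{n !≢0}}

-- The set {σ(1), …, σ(t)}: σ maps rounds, indexed from 0, to elements, so x has
-- been called within the first t rounds iff its index σ⁻¹(x) is less than t.

called : Permutation′ n → ℕ → Subset n
called σ t = tabulate λ x → does (toℕ (σ ⟨$⟩ˡ x) <? t)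

module _ (M : Matroid n) where

  -- The index i : Fin n stands for round i + 1.

  WinsInRound : Subset n → Permutation′ n → Fin n → Set
  WinsInRound C σ i = C ⊆ called σ (suc (toℕ i))
                    × ¬ ContainsCircuit M (called σ (toℕ i))

  Wins : Subset n → Pred (Permutation′ n) 0ℓ
  Wins C σ = ∃[ i ] WinsInRound C σ i

  wins? : ∀ C → Decidable (Wins C)
  wins? C σ = any? λ i →
    (C ⊆? called σ (suc (toℕ i))) ×-dec ¬? (containsCircuit? M (called σ (toℕ i)))

  β : Subset n → ℚ
  β C = probability (wins? C)

  Monotone : Set
  Monotone = ∀ {C₁ C₂} → Circuit M C₁ → Circuit M C₂ →
             ∣ C₁ ∣ > ∣ C₂ ∣ → β C₁ ℚ.< β C₂

{-# OPTIONS --safe #-}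

-- Fix circuits C₁ and C₂ with d = ∣C₁∣ > c = ∣C₂∣. A circuit can only win while
-- the previously called set is independent, hence within the first r + 1 rounds,
-- so C₁ wins for at most (r + 2)^(r + 1) (n − d)! orderings. On the other hand
-- C₂ wins whenever it consists of the first c elements called, which happens for
-- at least (n − c)! ≥ (n − d + 1) (n − d)! orderings.

module Submission where

open import Defs
import Algebra.Properties.CommutativeSemigroup as CommutativeSemigroup
open import Data.Bool.Base using (true; false)
open import Data.Fin.Base using (Fin; zero; suc; toℕ; fromℕ<; inject≤; punchIn)
open import Data.Fin.Permutation as Perm
  using (Permutation′; _⟨$⟩ʳ_; _⟨$⟩ˡ_; inverseˡ; inverseʳ)
open import Data.Fin.Properties
  using (toℕ<n; toℕ-fromℕ<; toℕ-inject≤; inject≤-injective; suc-injective)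
open import Data.Fin.Subset
  using (Subset; inside; outside; _∈_; _∉_; _⊆_; _⊂_; _-_; ∁; Nonempty; Empty; ∣_∣)
open import Data.Fin.Subset.Induction using (⊂-wellFounded; Acc; acc)
open import Data.Fin.Subset.Properties
  using (drop-there; Empty-unique; nonempty?; ∣⊥∣≡0; ∣∁p∣≡n∸∣p∣; ∣p∣≤n;
         x∈p∧x≢y⇒x∈p-y; x∈p⇒∣p-x∣<∣p∣; x∈p⇒p-x⊂p; p─⊥≡p; p⊂q⇒∣p∣<∣q∣;
         _∈?_; _⊂?_; anySubset?; ⊆-trans)
import Data.Integer.Base as ℤ
import Data.Integer.Properties as ℤ
open import Data.List.Base
  using ([]; _∷_; _++_; length; filter; map; allFin; cartesianProductWith)
import Data.List.Base as List
open import Data.List.Properties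
  using (length-++; filter-++; filter-all; filter-none; length-filter; map-tabulate)
import Data.List.Relation.Unary.All as All
open import Data.Nat.Base hiding (∣_-_∣)
open import Data.Nat.ListAction using (sum)
open import Data.Nat.Properties hiding (suc-injective)
open import Data.Product.Base using (∃-syntax; _,_; proj₁; proj₂)
open import Data.Rational.Base using () renaming (_<_ to _<ℚ_; _/_ to _/ℚ_)
open import Data.Rational.Properties using (toℚᵘ-cancel-<; toℚᵘ-fromℚᵘ)
open import Data.Rational.Unnormalised.Base using (mkℚᵘ; *<*)
import Data.Rational.Unnormalised.Properties as ℚᵘ
open import Data.Vec.Base as Vec using (_∷_; removeAt; lookup; here; there)
open import Data.Vec.Properties
  using (lookup∘tabulate; []=⇒lookup; lookup⇒[]=)
open import Function.Base using (_∘_; id)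
open import Function.Bundles using (Injection)
open import Function.Properties.Inverse using (↔⇒↣)
open import Level using (0ℓ)
open import Relation.Binary.PropositionalEquality
open import Relation.Nullary using (¬_; yes; no; does; contradiction)
open import Relation.Nullary.Decidable using (dec-true; dec-false; ¬?; _×-dec_)
open import Relation.Unary using (Pred; Decidable)

private
  variable
    n : ℕ

  module + = CommutativeSemigroup +-commutativeSemigroup
  module * = CommutativeSemigroup *-commutativeSemigroup

-- Finite subsets

∣p∣≤1+∣p-x∣ : ∀ (p : Subset n) x → ∣ p ∣ ≤ suc ∣ p - x ∣
∣p∣≤1+∣p-x∣ (outside ∷ p) zero    = m≤n⇒m≤1+n (≤-reflexive (cong ∣_∣ (sym (p─⊥≡p p))))
∣p∣≤1+∣p-x∣ (inside  ∷ p) zero    = s≤s (≤-reflexive (cong ∣_∣ (sym (p─⊥≡p p))))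
∣p∣≤1+∣p-x∣ (outside ∷ p) (suc x) = ∣p∣≤1+∣p-x∣ p x
∣p∣≤1+∣p-x∣ (inside  ∷ p) (suc x) = s≤s (∣p∣≤1+∣p-x∣ p x)

injection⇒≤∣p∣ : ∀ {m} {p : Subset n} (f : Fin m → Fin n) →
                 (∀ {i j} → f i ≡ f j → i ≡ j) → (∀ i → f i ∈ p) → m ≤ ∣ p ∣
injection⇒≤∣p∣ {m = zero}  f f-inj f∈p = z≤n
injection⇒≤∣p∣ {m = suc m} {p} f f-inj f∈p = ≤-<-trans
  (injection⇒≤∣p∣ {p = p - f zero} (f ∘ suc) (suc-injective ∘ f-inj)
    λ i → x∈p∧x≢y⇒x∈p-y (f∈p (suc i)) λ eq → contradiction (f-inj {suc i} {zero} eq) λ ())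
  (x∈p⇒∣p-x∣<∣p∣ (f∈p zero))

x∈p⇒1+∣removeAt∣≡∣p∣ : ∀ {p : Subset (suc n)} {x} → x ∈ p → suc ∣ removeAt p x ∣ ≡ ∣ p ∣
x∈p⇒1+∣removeAt∣≡∣p∣ here = refl
x∈p⇒1+∣removeAt∣≡∣p∣ {p = inside  ∷ p@(_ ∷ _)} (there x∈p) = cong suc (x∈p⇒1+∣removeAt∣≡∣p∣ x∈p)
x∈p⇒1+∣removeAt∣≡∣p∣ {p = outside ∷ p@(_ ∷ _)} (there x∈p) = x∈p⇒1+∣removeAt∣≡∣p∣ x∈p

x∉p⇒∣removeAt∣≡∣p∣ : ∀ {p : Subset (suc n)} {x} → x ∉ p → ∣ removeAt p x ∣ ≡ ∣ p ∣
x∉p⇒∣removeAt∣≡∣p∣ {p = inside  ∷ p} {zero} x∉p = contradiction here x∉p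
x∉p⇒∣removeAt∣≡∣p∣ {p = outside ∷ p} {zero} x∉p = refl
x∉p⇒∣removeAt∣≡∣p∣ {p = inside  ∷ p@(_ ∷ _)} {suc x} x∉p =
  cong suc (x∉p⇒∣removeAt∣≡∣p∣ (x∉p ∘ there))
x∉p⇒∣removeAt∣≡∣p∣ {p = outside ∷ p@(_ ∷ _)} {suc x} x∉p =
  x∉p⇒∣removeAt∣≡∣p∣ (x∉p ∘ there)

x∈p⇒∣∁removeAt∣≡∣∁p∣ : ∀ {p : Subset (suc n)} {x} → x ∈ p → ∣ ∁ (removeAt p x) ∣ ≡ ∣ ∁ p ∣
x∈p⇒∣∁removeAt∣≡∣∁p∣ {n} {p} {x} x∈p = begin
  ∣ ∁ (removeAt p x) ∣         ≡⟨ ∣∁p∣≡n∸∣p∣ (removeAt p x) ⟩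
  suc n ∸ suc ∣ removeAt p x ∣ ≡⟨ cong (suc n ∸_) (x∈p⇒1+∣removeAt∣≡∣p∣ x∈p) ⟩
  suc n ∸ ∣ p ∣                ≡⟨ ∣∁p∣≡n∸∣p∣ p ⟨
  ∣ ∁ p ∣                      ∎
  where open ≡-Reasoning

x∉p⇒1+∣∁removeAt∣≡∣∁p∣ : ∀ {p : Subset (suc n)} {x} → x ∉ p → suc ∣ ∁ (removeAt p x) ∣ ≡ ∣ ∁ p ∣
x∉p⇒1+∣∁removeAt∣≡∣∁p∣ {n} {p} {x} x∉p = begin
  suc ∣ ∁ (removeAt p x) ∣     ≡⟨ cong suc (∣∁p∣≡n∸∣p∣ (removeAt p x)) ⟩
  suc (n ∸ ∣ removeAt p x ∣)   ≡⟨ +-∸-assoc 1 (∣p∣≤n (removeAt p x)) ⟨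
  suc n ∸ ∣ removeAt p x ∣     ≡⟨ cong (suc n ∸_) (x∉p⇒∣removeAt∣≡∣p∣ x∉p) ⟩
  suc n ∸ ∣ p ∣                ≡⟨ ∣∁p∣≡n∸∣p∣ p ⟨
  ∣ ∁ p ∣                      ∎
  where open ≡-Reasoning

lookup-punchIn : ∀ (p : Subset (suc n)) x y → lookup p (punchIn x y) ≡ lookup (removeAt p x) y
lookup-punchIn (s ∷ p)         zero    y       = refl
lookup-punchIn (s ∷ p@(_ ∷ _)) (suc x) zero    = refl
lookup-punchIn (s ∷ p@(_ ∷ _)) (suc x) (suc y) = lookup-punchIn p x y

-- `Perm.insert zero x` relabels the elements other than `x` by `punchIn x`, and `removeAt p x` is
-- what is left of `p` under the same relabelling. This carries membership from the rest of an
-- ordering back to the whole.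
∈-removeAt⁻ : ∀ {p : Subset (suc n)} {x y} → y ∈ removeAt p x → punchIn x y ∈ p
∈-removeAt⁻ {p = p} {x} {y} h =
  lookup⇒[]= (punchIn x y) p (trans (lookup-punchIn p x y) ([]=⇒lookup h))

∣p∣+∣∁p∣≡n : ∀ (p : Subset n) → ∣ p ∣ + ∣ ∁ p ∣ ≡ n
∣p∣+∣∁p∣≡n p = trans (cong (∣ p ∣ +_) (∣∁p∣≡n∸∣p∣ p)) (m+[n∸m]≡n (∣p∣≤n p))

Empty⇒∣p∣≡0 : ∀ {p : Subset n} → Empty p → ∣ p ∣ ≡ 0
Empty⇒∣p∣≡0 {n} ∄x = trans (cong ∣_∣ (Empty-unique ∄x)) (∣⊥∣≡0 n)

Empty⇒∣∁p∣≡n : ∀ {p : Subset n} → Empty p → ∣ ∁ p ∣ ≡ n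
Empty⇒∣∁p∣≡n {p = p} ∄x =
  trans (cong (_+ ∣ ∁ p ∣) (sym (Empty⇒∣p∣≡0 ∄x))) (∣p∣+∣∁p∣≡n p)

-- Serves to split the choice of the first called element according to whether it lies in the
-- circuit.
sum-tabulate-≤ : ∀ (p : Subset n) (f : Fin n → ℕ) {a b} →
                 (∀ {x} → x ∈ p → f x ≤ a) → (∀ {x} → x ∉ p → f x ≤ b) →
                 sum (List.tabulate f) ≤ ∣ p ∣ * a + ∣ ∁ p ∣ * b
sum-tabulate-≤ Vec.[] f f≤a f≤b = z≤n
sum-tabulate-≤ (inside ∷ p) f {a} {b} f≤a f≤b = begin
  f zero + sum (List.tabulate (f ∘ suc))
    ≤⟨ +-mono-≤ (f≤a here) (sum-tabulate-≤ p (f ∘ suc) (f≤a ∘ there) (f≤b ∘ (_∘ drop-there))) ⟩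
  a + (∣ p ∣ * a + ∣ ∁ p ∣ * b)
    ≡⟨ +-assoc a _ _ ⟨
  a + ∣ p ∣ * a + ∣ ∁ p ∣ * b
    ∎
  where open ≤-Reasoning
sum-tabulate-≤ (outside ∷ p) f {a} {b} f≤a f≤b = begin
  f zero + sum (List.tabulate (f ∘ suc))
    ≤⟨ +-mono-≤ (f≤b λ ()) (sum-tabulate-≤ p (f ∘ suc) (f≤a ∘ there) (f≤b ∘ (_∘ drop-there))) ⟩
  b + (∣ p ∣ * a + ∣ ∁ p ∣ * b)
    ≡⟨ +.x∙yz≈y∙xz b (∣ p ∣ * a) _ ⟩
  ∣ p ∣ * a + (b + ∣ ∁ p ∣ * b)
    ∎
  where open ≤-Reasoning

fx≤sum-tabulate : ∀ (f : Fin n → ℕ) x → f x ≤ sum (List.tabulate f)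
fx≤sum-tabulate f zero    = m≤m+n _ _
fx≤sum-tabulate f (suc x) = m≤n⇒m≤o+n (f zero) (fx≤sum-tabulate (f ∘ suc) x)

-- Counting orderings by their first element

filter-map-length : ∀ {A B : Set} {P : Pred B 0ℓ} (P? : Decidable P) (f : A → B) xs →
                    length (filter P? (map f xs)) ≡ length (filter (P? ∘ f) xs)
filter-map-length P? f []       = refl
filter-map-length P? f (x ∷ xs) with does (P? (f x))
... | true  = cong suc (filter-map-length P? f xs)
... | false = filter-map-length P? f xs

filter-cartesianProductWith-length :
  ∀ {A B C : Set} {P : Pred C 0ℓ} (P? : Decidable P) (f : A → B → C) xs ys →
  length (filter P? (cartesianProductWith f xs ys)) ≡
  sum (map (λ x → length (filter (P? ∘ f x) ys)) xs)
filter-cartesianProductWith-length P? f []       ys = refl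
filter-cartesianProductWith-length P? f (x ∷ xs) ys = begin
  length (filter P? (map (f x) ys ++ zs))
    ≡⟨ cong length (filter-++ P? (map (f x) ys) zs) ⟩
  length (filter P? (map (f x) ys) ++ filter P? zs)
    ≡⟨ length-++ (filter P? (map (f x) ys)) ⟩
  length (filter P? (map (f x) ys)) + length (filter P? zs)
    ≡⟨ cong₂ _+_ (filter-map-length P? (f x) ys)
                 (filter-cartesianProductWith-length P? f xs ys) ⟩
  length (filter (P? ∘ f x) ys) + sum (map (λ x → length (filter (P? ∘ f x) ys)) xs)
    ∎
  where
  open ≡-Reasoning
  zs = cartesianProductWith f xs ys

-- The numerator in `probability` before the fraction is reduced.
count : {P : Pred (Permutation′ n) 0ℓ} → Decidable P → ℕ
count {n} P? = length (filter P? (orderings n))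

count-first : {P : Pred (Permutation′ (suc n)) 0ℓ} (P? : Decidable P) →
              count P? ≡ sum (List.tabulate λ x → count (P? ∘ Perm.insert zero x))
count-first {n} P? = trans
  (filter-cartesianProductWith-length P? (Perm.insert zero) (allFin (suc n)) (orderings n))
  (cong sum (map-tabulate id λ x → count (P? ∘ Perm.insert zero x)))

count-none : {P : Pred (Permutation′ n) 0ℓ} (P? : Decidable P) → (∀ {σ} → ¬ P σ) → count P? ≡ 0
count-none {n} P? ¬p = cong length (filter-none P? (All.universal (λ _ → ¬p) (orderings n)))

count-all : {P : Pred (Permutation′ n) 0ℓ} (P? : Decidable P) → (∀ σ → P σ) → count P? ≡ n !
count-all {n} P? p =
  trans (cong length (filter-all P? (All.universal p (orderings n)))) (length-orderings n)

count≤n! : {P : Pred (Permutation′ n) 0ℓ} (P? : Decidable P) → count P? ≤ n !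
count≤n! {n} P? = ≤-trans (length-filter P? (orderings n)) (≤-reflexive (length-orderings n))

-- Phrased through rounds `k` and `σ ⟨$⟩ʳ k`, since `Perm.insert zero x π` computes in that
-- direction: round `suc k` of it calls `punchIn x (π ⟨$⟩ʳ k)`.
CalledWithin : Subset n → ℕ → Permutation′ n → Set
CalledWithin C s σ = ∀ k → σ ⟨$⟩ʳ k ∈ C → toℕ k < s

CalledFirst : Subset n → Permutation′ n → Set
CalledFirst C σ = ∀ k → toℕ k < ∣ C ∣ → σ ⟨$⟩ʳ k ∈ C

-- Induction on `s`, by the first called element. Each of the `∣ C ∣` choices inside `C` leaves
-- `∁ C` at size `e` and contributes at most `K ^ s * e !`; the `e` choices outside contribute at
-- most that much together. The factor `suc ∣ C ∣` is then absorbed by `K`, which can stay fixed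
-- because `C` never grows. An arbitrary `P` lets the induction pass to `P? ∘ Perm.insert zero x`.
count-CalledWithin-≤ :
  ∀ (C : Subset n) s {K} → ∣ C ∣ < K → {P : Pred (Permutation′ n) 0ℓ} (P? : Decidable P) →
  (∀ {σ} → P σ → CalledWithin C s σ) → count P? ≤ K ^ s * ∣ ∁ C ∣ !
count-CalledWithin-≤ C s {K} C<K P? P⇒within with nonempty? C
... | no ∄x rewrite Empty⇒∣∁p∣≡n ∄x =
  ≤-trans (count≤n! P?) (m≤n*m _ (K ^ s) {{m^n≢0 K s {{>-nonZero (≤-<-trans z≤n C<K)}}}})
-- No element of `C` can be called within zero rounds, so no ordering qualifies.
count-CalledWithin-≤ C zero C<K P? P⇒within | yes (x , x∈C) =
  ≤-trans (≤-reflexive (count-none P? λ {σ} p →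
    n≮0 (P⇒within p (σ ⟨$⟩ˡ x) (subst (_∈ C) (sym (inverseʳ σ)) x∈C)))) z≤n
count-CalledWithin-≤ {n = suc n} C (suc s) {K} C<K {P} P? P⇒within | yes _ = begin
  count P?
    ≡⟨ count-first P? ⟩
  sum (List.tabulate λ x → count (P? ∘ Perm.insert zero x))
    ≤⟨ sum-tabulate-≤ C _ bound-∈ bound-∉ ⟩
  ∣ C ∣ * X + e * (K ^ s * pred e !)
    ≡⟨ cong (∣ C ∣ * X +_) (*.x∙yz≈y∙xz e (K ^ s) _) ⟩
  ∣ C ∣ * X + K ^ s * (e * pred e !)
    ≤⟨ +-monoʳ-≤ (∣ C ∣ * X) (*-monoʳ-≤ (K ^ s) (n*[pred[n]]!≤n! e)) ⟩
  ∣ C ∣ * X + X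
    ≡⟨ +-comm (∣ C ∣ * X) X ⟩
  suc ∣ C ∣ * X
    ≤⟨ *-monoˡ-≤ X C<K ⟩
  K * X
    ≡⟨ *-assoc K (K ^ s) (e !) ⟨
  K ^ suc s * e !
    ∎
  where
  open ≤-Reasoning
  e = ∣ ∁ C ∣
  X = K ^ s * e !

  -- Only an inequality, because `e` may be 0: then no first element lies outside `C`, and the left
  -- side is 0 while `0 !` is 1.
  n*[pred[n]]!≤n! : ∀ n → n * pred n ! ≤ n !
  n*[pred[n]]!≤n! zero    = z≤n
  n*[pred[n]]!≤n! (suc n) = ≤-refl

  within-removeAt : ∀ {x π} → P (Perm.insert zero x π) → CalledWithin (removeAt C x) s π
  within-removeAt p k h = s<s⁻¹ (P⇒within p (suc k) (∈-removeAt⁻ h))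

  bound : ∀ x → ∣ removeAt C x ∣ < K →
          count (P? ∘ Perm.insert zero x) ≤ K ^ s * ∣ ∁ (removeAt C x) ∣ !
  bound x C′<K =
    count-CalledWithin-≤ (removeAt C x) s C′<K (P? ∘ Perm.insert zero x) within-removeAt

  bound-∈ : ∀ {x} → x ∈ C → count (P? ∘ Perm.insert zero x) ≤ X
  bound-∈ {x} x∈C = subst (λ m → _ ≤ K ^ s * m !) (x∈p⇒∣∁removeAt∣≡∣∁p∣ x∈C)
    (bound x (<-trans (≤-reflexive (x∈p⇒1+∣removeAt∣≡∣p∣ x∈C)) C<K))

  bound-∉ : ∀ {x} → x ∉ C → count (P? ∘ Perm.insert zero x) ≤ K ^ s * pred e !
  bound-∉ {x} x∉C = subst (λ m → _ ≤ K ^ s * m !) (cong pred (x∉p⇒1+∣∁removeAt∣≡∣∁p∣ x∉C))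
    (bound x (subst (_< K) (sym (x∉p⇒∣removeAt∣≡∣p∣ x∉C)) C<K))

-- Each step keeps just one first element `x` of `C`, so in effect only the orderings that begin
-- with one fixed enumeration of `C` are counted. The lost factor `∣ C ∣ !` does not matter for the
-- comparison.
count-CalledFirst-≥ :
  ∀ (C : Subset n) {P : Pred (Permutation′ n) 0ℓ} (P? : Decidable P) →
  (∀ {σ} → CalledFirst C σ → P σ) → ∣ ∁ C ∣ ! ≤ count P?
count-CalledFirst-≥ C P? first⇒P with nonempty? C
... | no ∄x = ≤-reflexive (trans (cong _! (Empty⇒∣∁p∣≡n ∄x))
    (sym (count-all P? λ σ → first⇒P λ k k<∣C∣ →
      contradiction k<∣C∣ (subst (λ m → ¬ (toℕ k < m)) (sym (Empty⇒∣p∣≡0 ∄x)) n≮0))))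
count-CalledFirst-≥ {n = suc n} C {P} P? first⇒P | yes (x , x∈C) = begin
  ∣ ∁ C ∣ !
    ≡⟨ cong _! (x∈p⇒∣∁removeAt∣≡∣∁p∣ x∈C) ⟨
  ∣ ∁ (removeAt C x) ∣ !
    ≤⟨ count-CalledFirst-≥ (removeAt C x) (P? ∘ Perm.insert zero x) (first⇒P ∘ first) ⟩
  count (P? ∘ Perm.insert zero x)
    ≤⟨ fx≤sum-tabulate (λ x → count (P? ∘ Perm.insert zero x)) x ⟩
  sum (List.tabulate λ x → count (P? ∘ Perm.insert zero x))
    ≡⟨ count-first P? ⟨
  count P?
    ∎
  where
  open ≤-Reasoning

  first : ∀ {π} → CalledFirst (removeAt C x) π → CalledFirst C (Perm.insert zero x π)
  first h zero    _ = x∈C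
  first h (suc k) k<C =
    ∈-removeAt⁻ (h k (s<s⁻¹ (subst (suc (toℕ k) <_) (sym (x∈p⇒1+∣removeAt∣≡∣p∣ x∈C)) k<C)))

-- The bingo game

∈-called⁺ : ∀ (σ : Permutation′ n) {t x} → toℕ (σ ⟨$⟩ˡ x) < t → x ∈ called σ t
∈-called⁺ σ {t} {x} h =
  lookup⇒[]= x _ (trans (lookup∘tabulate _ x) (dec-true (toℕ (σ ⟨$⟩ˡ x) <? t) h))

∈-called⁻ : ∀ (σ : Permutation′ n) {t x} → x ∈ called σ t → toℕ (σ ⟨$⟩ˡ x) < t
∈-called⁻ σ {t} {x} h with toℕ (σ ⟨$⟩ˡ x) <? t
... | yes p = p
... | no ¬p = contradiction
  (trans (sym ([]=⇒lookup h))
    (trans (lookup∘tabulate _ x) (dec-false (toℕ (σ ⟨$⟩ˡ x) <? t) ¬p)))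
  λ ()

-- The first `t` values of `σ` are distinct and have all been called.
t≤∣called∣ : ∀ (σ : Permutation′ n) {t} → t ≤ n → t ≤ ∣ called σ t ∣
t≤∣called∣ σ t≤n = injection⇒≤∣p∣ (λ i → σ ⟨$⟩ʳ inject≤ i t≤n)
  (λ eq → inject≤-injective t≤n t≤n _ _ (Injection.injective (↔⇒↣ σ) eq))
  (λ i → ∈-called⁺ σ (subst (_< _)
    (sym (trans (cong toℕ (inverseˡ σ)) (toℕ-inject≤ i t≤n))) (toℕ<n i)))

module _ (M : Matroid n) where
  open Matroid M

  -- Descent along `⊂`: a dependent set either has a dependent proper subset or is itself a circuit.
  dependent⇒containsCircuit : ∀ {S} → ¬ Independent S → ContainsCircuit M S
  dependent⇒containsCircuit {S} = go S (⊂-wellFounded S)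
    where
    go : ∀ S → Acc _⊂_ S → ¬ Independent S → ContainsCircuit M S
    go S (acc rs) ¬iS with anySubset? (λ D → (D ⊂? S) ×-dec ¬? (independent? D))
    ... | yes (D , D⊂S , ¬iD) with go D (rs D⊂S) ¬iD
    ...   | C , circ , C⊆D = C , circ , ⊆-trans C⊆D (proj₁ D⊂S)
    go S (acc rs) ¬iS | no ∄D = S , (¬iS , minimal) , id
      where
      minimal : ∀ {D} → D ⊂ S → Independent D
      minimal {D} D⊂S with independent? D
      ... | yes iD = iD
      ... | no ¬iD = contradiction (D , D⊂S , ¬iD) ∄D

  circuit-nonempty : ∀ {C} → Circuit M C → Nonempty C
  circuit-nonempty {C} (¬iC , _) with nonempty? C
  ... | yes ne = ne
  ... | no ∄x  = contradiction (subst Independent (sym (Empty-unique ∄x)) ∅-independent) ¬iC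

  module _ {r} (rank : HasRank M r) where

    -- Deleting one element of a circuit leaves an independent set, of size at most `r`.
    ∣circuit∣≤1+r : ∀ {C} → Circuit M C → ∣ C ∣ ≤ suc r
    ∣circuit∣≤1+r {C} circ with circuit-nonempty circ
    ... | x , x∈C = ≤-trans (∣p∣≤1+∣p-x∣ C x) (s≤s (proj₂ rank (proj₂ circ (x∈p⇒p-x⊂p x∈C))))

    -- The set called before the winning round contains no circuit, so it is independent and has at
    -- most `r` elements. Hence the round index `i` is at most `r`.
    wins⇒calledWithin : ∀ {C σ} → Wins M C σ → CalledWithin C (suc r) σ
    wins⇒calledWithin {C} {σ} (i , C⊆called , ∄circuit) k σk∈C =
      ≤-trans (subst (λ j → toℕ j < suc (toℕ i)) (inverseˡ σ) (∈-called⁻ σ (C⊆called σk∈C)))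
              (s≤s i≤r)
      where
      i≤r : toℕ i ≤ r
      i≤r with independent? (called σ (toℕ i))
      ... | yes ind = ≤-trans (t≤∣called∣ σ (<⇒≤ (toℕ<n i))) (proj₂ rank ind)
      ... | no ¬ind = contradiction (dependent⇒containsCircuit ¬ind) ∄circuit

  -- After `∣ C ∣` rounds exactly `C` has been called. One round earlier the called set is a proper
  -- subset of `C`, so every set inside it is independent by minimality of the circuit.
  calledFirst⇒wins : ∀ {C σ} → Circuit M C → CalledFirst C σ → Wins M C σ
  calledFirst⇒wins {C} {σ} circ first with ∣ C ∣ in ∣C∣≡ | circuit-nonempty circ
  -- A circuit is nonempty, so its size has the form `suc c`, and `c` is the index of the round that
  -- completes it.
  ... | zero | x , x∈C = contradiction (subst (∣ C - x ∣ <_) ∣C∣≡ (x∈p⇒∣p-x∣<∣p∣ x∈C)) n≮0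
  ... | suc c | _ = i , subst (λ t → C ⊆ called σ (suc t)) (sym i≡c) C⊆called ,
    λ (D , (¬iD , _) , D⊆) → ¬iD (proj₂ circ (D⊂C D⊆))
    where
    1+c≤n : suc c ≤ n
    1+c≤n = subst (_≤ n) ∣C∣≡ (∣p∣≤n C)

    i : Fin n
    i = fromℕ< 1+c≤n

    i≡c : toℕ i ≡ c
    i≡c = toℕ-fromℕ< 1+c≤n

    called⊆C : called σ (suc c) ⊆ C
    called⊆C x∈called = subst (_∈ C) (inverseʳ σ) (first _ (∈-called⁻ σ x∈called))

    -- By cardinality: if an element of `C` were missing, the called set would be a proper subset of
    -- `C` and have fewer than `suc c` elements.
    C⊆called : C ⊆ called σ (suc c)
    C⊆called {x} x∈C with x ∈? called σ (suc c)
    ... | yes x∈called = x∈called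
    ... | no  x∉called = contradiction
      (<-≤-trans (subst (_ <_) ∣C∣≡ (p⊂q⇒∣p∣<∣q∣ (called⊆C , x , x∈C , x∉called)))
                 (t≤∣called∣ σ 1+c≤n))
      (<-irrefl refl)

    σi∉called : σ ⟨$⟩ʳ i ∉ called σ (toℕ i)
    σi∉called h = <-irrefl refl (subst (λ j → toℕ j < toℕ i) (inverseˡ σ) (∈-called⁻ σ h))

    -- The element called in round `i` itself witnesses properness: it lies in `C` but has not been
    -- called before.
    D⊂C : ∀ {D} → D ⊆ called σ (toℕ i) → D ⊂ C
    D⊂C D⊆ = (λ x∈D → called⊆C (∈-called⁺ σ (m<n⇒m<1+n (subst (_ <_) i≡c (∈-called⁻ σ (D⊆ x∈D))))))
           , σ ⟨$⟩ʳ i , first i (s≤s (≤-reflexive i≡c)) , σi∉called ∘ D⊆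

-- Factorials, fractions and the comparison of the two counts

!-mono-≤ : ∀ {m n} → m ≤ n → m ! ≤ n !
!-mono-≤ {n = n} z≤n   = 1≤n! n
!-mono-≤ (s≤s m≤n) = *-mono-≤ (s≤s m≤n) (!-mono-≤ m≤n)

-- `_/ℚ_` reduces to lowest terms, which may change the two denominators differently. In the
-- unnormalised rationals both remain `m`.
/-monoˡ-< : ∀ {a b} m .{{_ : NonZero m}} → a < b → (ℤ.+ a /ℚ m) <ℚ (ℤ.+ b /ℚ m)
/-monoˡ-< {a} {b} (suc m) a<b = toℚᵘ-cancel-<
  (ℚᵘ.<-respˡ-≃ (ℚᵘ.≃-sym (toℚᵘ-fromℚᵘ (mkℚᵘ (ℤ.+ a) m)))
  (ℚᵘ.<-respʳ-≃ (ℚᵘ.≃-sym (toℚᵘ-fromℚᵘ (mkℚᵘ (ℤ.+ b) m)))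
  (*<* (ℤ.*-monoʳ-<-pos (ℤ.+ suc m) (ℤ.+<+ a<b)))))

theorem8 : ∀ (r : ℕ) → ∃[ N ] (∀ {n} (M : Matroid n) → HasRank M r → n ≥ N → Monotone M)
-- The summand `suc r` pays for the at most `suc r` elements of `C₁`, so that at least `K ^ suc r`
-- elements remain outside it.
theorem8 r = suc r + K ^ suc r , λ {n} M rank n≥N {C₁} {C₂} circ₁ circ₂ ∣C₁∣>∣C₂∣ →
  let
    e₁ = ∣ ∁ C₁ ∣
    e₂ = ∣ ∁ C₂ ∣

    ∣C₁∣≤1+r = ∣circuit∣≤1+r M rank circ₁

    K^[1+r]≤e₁ : K ^ suc r ≤ e₁
    K^[1+r]≤e₁ = +-cancelˡ-≤ (suc r) _ _ (≤-trans n≥N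
      (≤-trans (≤-reflexive (sym (∣p∣+∣∁p∣≡n C₁))) (+-monoˡ-≤ e₁ ∣C₁∣≤1+r)))

    e₁<e₂ : e₁ < e₂
    e₁<e₂ = subst₂ _<_ (sym (∣∁p∣≡n∸∣p∣ C₁)) (sym (∣∁p∣≡n∸∣p∣ C₂))
      (∸-monoʳ-< ∣C₁∣>∣C₂∣ (∣p∣≤n C₁))

    open ≤-Reasoning
  in /-monoˡ-< (n !) {{n !≢0}} (begin-strict
    count (wins? M C₁)
      ≤⟨ count-CalledWithin-≤ C₁ (suc r) (s≤s ∣C₁∣≤1+r) (wins? M C₁)
           (λ {σ} → wins⇒calledWithin M rank {σ = σ}) ⟩
    K ^ suc r * e₁ !
      -- Strictness arises here, from `K ^ suc r < suc e₁` and `e₁ ! > 0`; `suc e₁ !` unfolds to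
      -- `suc e₁ * e₁ !`.
      <⟨ *-monoˡ-< (e₁ !) {{e₁ !≢0}} (s≤s K^[1+r]≤e₁) ⟩
    suc e₁ !
      ≤⟨ !-mono-≤ e₁<e₂ ⟩
    e₂ !
      ≤⟨ count-CalledFirst-≥ C₂ (wins? M C₂) (λ {σ} → calledFirst⇒wins M {σ = σ} circ₂) ⟩
    count (wins? M C₂)
      ∎)
  where
  -- The least value exceeding the bound `suc r` on circuit sizes.
  K = 2 + r
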